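{- Let $m\ge 2$ be a prime and $n\ge 1$ an integer. If $p(m,n)\neq 0$, then $n \equiv r \pmod{m^2}$ for some $r\in\{ -1,0,1,\dots,m-2\}$.
   Context: For integers $m\ge 2$, $n\ge 1$, a valid $(m,n)$-sequence is a sequence $(a_1,\dots,a_{mn})$ with entries in $\{1,\dots,n\}$ in which each $k\in\{1,\dots,n\}$ occurs exactly $m$ times, and such that any two consecutive occurrences of $k$ are separated by exactly $k$ other terms; equivalently, there is an index $\theta_k$ such that $k$ occurs exactly at the positions $\theta_k,\ \theta_k+(k+1),\ \theta_k+2(k+1),\dots,\theta_k+(m-1)(k+1)$ (all in $\{1,\dots,mn\}$). Example: $3\,1\,2\,1\,3\,2$ is a valid $(2,3)$-sequence. The reversal $(a_{mn},\dots,a_1)$ of a valid sequence is again valid; $p(m,n)$ denotes the number of valid $(m,n)$-sequences counted up to reversal (i.e. the number of equivalence classes of valid $(m,n)$-sequences under identifying a sequence with its reversal). -}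

module Defs where

open import Data.Fin.Base using (Fin; toℕ)
import Data.Fin.Base as Fin
import Data.Fin.Properties as Fin
open import Data.Integer.Base as ℤ using (ℤ)
open import Data.Integer.Divisibility.Signed using (_∣_)
open import Data.List.Base
  using (List; []; _∷_; length; filter; deduplicate; allFin; cartesianProductWith)
open import Data.List.Membership.Propositional using (_∈_)
open import Data.List.Membership.Propositional.Properties
  using (∈-allFin; ∈-cartesianProductWith⁺)
open import Data.List.Relation.Unary.Any using (here)
open import Data.Nat.Base using (ℕ; zero; suc; _+_; _*_)
import Data.Nat.Properties as ℕ
open import Data.Product.Base using (_×_)
open import Data.Sum.Base using (_⊎_)
open import Data.Vec.Base using (Vec; []; _∷_; lookup; count; reverse)
open import Data.Vec.Properties using (≡-dec)
open import Relation.Binary.Definitions using () renaming (Decidable to Decidable₂)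
open import Relation.Binary.PropositionalEquality using (_≡_; _≢_; refl)
open import Relation.Nullary.Decidable using (¬?; _×-dec_; _⊎-dec_; _→-dec_)
open import Relation.Unary using (Decidable)

-- The letter k ∈ {1,…,n} is represented by the element k - 1 of Fin n.
value : ∀ {n} → Fin n → ℕ
value x = suc (toℕ x)

module _ {n l : ℕ} where

  Consecutive : Vec (Fin n) l → Fin n → Fin l → Fin l → Set
  Consecutive a x i j =
    i Fin.< j × lookup a i ≡ x × lookup a j ≡ x ×
    (∀ h → i Fin.< h → h Fin.< j → lookup a h ≢ x)

  -- Exactly `value x` positions lie strictly between i and j
  -- iff j = i + value x + 1.
  IsValid : ℕ → Vec (Fin n) l → Set
  IsValid m a =
    ∀ x → count (Fin._≟ x) a ≡ m ×
          (∀ i j → Consecutive a x i j → toℕ j ≡ suc (toℕ i + value x))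

  consecutive? : ∀ a x i → Decidable (Consecutive a x i)
  consecutive? a x i j =
    (i Fin.<? j) ×-dec (lookup a i Fin.≟ x) ×-dec (lookup a j Fin.≟ x) ×-dec
    Fin.all? (λ h → (i Fin.<? h) →-dec ((h Fin.<? j) →-dec ¬? (lookup a h Fin.≟ x)))

  isValid? : ∀ m → Decidable (IsValid m)
  isValid? m a = Fin.all? λ x →
    (count (Fin._≟ x) a ℕ.≟ m) ×-dec
    Fin.all? (λ i → Fin.all? (λ j →
      consecutive? a x i j →-dec (toℕ j ℕ.≟ suc (toℕ i + value x))))

  _≈ʳ_ : Vec (Fin n) l → Vec (Fin n) l → Set
  a ≈ʳ b = a ≡ b ⊎ a ≡ reverse b

  _≈ʳ?_ : Decidable₂ _≈ʳ_
  a ≈ʳ? b = ≡-dec Fin._≟_ a b ⊎-dec ≡-dec Fin._≟_ a (reverse b)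

allVecs : ∀ n l → List (Vec (Fin n) l)
allVecs n zero    = [] ∷ []
allVecs n (suc l) = cartesianProductWith _∷_ (allFin n) (allVecs n l)

∈-allVecs : ∀ {n l} (a : Vec (Fin n) l) → a ∈ allVecs n l
∈-allVecs []      = here refl
∈-allVecs (x ∷ a) = ∈-cartesianProductWith⁺ _∷_ (∈-allFin x) (∈-allVecs a)

validSequences : ∀ m n → List (Vec (Fin n) (m * n))
validSequences m n = filter (isValid? m) (allVecs n (m * n))

-- `deduplicate` keeps exactly one representative of each ≈ʳ-class.
p : ℕ → ℕ → ℕ
p m n = length (deduplicate _≈ʳ?_ (validSequences m n))

infix 4 _≡_[mod_]

_≡_[mod_] : ℤ → ℤ → ℤ → Set
a ≡ b [mod d ] = d ∣ a ℤ.- b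

{-# OPTIONS --safe #-}
-- Count the positions divisible by m; there are n of them. The occurrences of k
-- form an arithmetic progression of length m and difference d = k + 1, which
-- meets the multiples of m exactly once if m ∤ d, and 0 or m times if m ∣ d.
-- Hence m divides the number ⌊(n + 1) / m⌋ of d ∈ {2, …, n + 1} with m ∣ d, so
-- n + 1 = s + e m² with 0 ≤ s < m.
module Submission where

open import Defs
open import Data.Nat.Base using (ℕ; _^_) renaming (_≤_ to _≤ᴺ_)
open import Data.Nat.Primality using (Prime)
open import Data.Integer.Base using (+_; _-_; -1ℤ; _≤_)
open import Data.Product.Base using (∃-syntax; _×_)
open import Relation.Binary.PropositionalEquality using (_≢_)

open import Data.Bool.Base using (if_then_else_)
open import Data.Fin.Base as Fin using (Fin; zero; suc; toℕ; fromℕ<; punchIn)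
import Data.Fin.Properties as Fin
import Data.Integer.Base as ℤ
open import Data.Integer.Divisibility.Signed using (divides)
import Data.Integer.Properties as ℤ
import Data.Integer.Tactic.RingSolver as ℤ-Solver
open import Data.List.Base using ([]; _∷_)
open import Data.List.Relation.Unary.All using (_∷_)
open import Data.List.Relation.Unary.All.Properties using (all-filter)
open import Data.Nat.Base using (zero; suc; _+_; _*_; _∸_; _<_; z≤n; s≤s; NonZero; >-nonZero)
open import Data.Nat.Divisibility
open import Data.Nat.DivMod using (_/_; _%_; m≡m%n+[m/n]*n; m%n<n)
open import Data.Nat.Primality using (euclidsLemma; prime⇒nonZero)
open import Data.Nat.Properties
import Data.Nat.Tactic.RingSolver as ℕ-Solver
open import Data.Product.Base using (_,_; proj₁; proj₂)
open import Data.Sum.Base using (_⊎_; inj₁; inj₂; [_,_]′)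
open import Data.Vec.Base using (Vec; []; _∷_; lookup; count)
open import Function.Base using (_∘_; case_of_)
open import Relation.Binary.PropositionalEquality
  using (_≡_; refl; sym; trans; cong; cong₂; subst; module ≡-Reasoning)
open import Relation.Binary.Definitions using (tri<; tri≈; tri>)
open import Relation.Nullary.Decidable using (Dec; yes; no; does)
open import Relation.Nullary.Negation using (¬_; contradiction)
open import Algebra.Properties.Semiring.Sum +-*-semiring

-- Indicators and finite sums.

𝟙 : ∀ {p} {P : Set p} → Dec P → ℕ
𝟙 P? = if does P? then 1 else 0

𝟙-yes : ∀ {p} {P : Set p} (P? : Dec P) → P → 𝟙 P? ≡ 1
𝟙-yes (yes _) _ = refl
𝟙-yes (no ¬p) p = contradiction p ¬p

𝟙-no : ∀ {p} {P : Set p} (P? : Dec P) → ¬ P → 𝟙 P? ≡ 0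
𝟙-no (yes p) ¬p = contradiction p ¬p
𝟙-no (no _)  _  = refl

sum-zero : ∀ {n} (t : Fin n → ℕ) → (∀ i → t i ≡ 0) → sum t ≡ 0
sum-zero {n} t t≡0 = trans (sum-cong-≗ t≡0) (sum-replicate-zero n)

sum-single : ∀ {n} (t : Fin n → ℕ) i → (∀ j → j ≢ i → t j ≡ 0) → sum t ≡ t i
sum-single {suc n} t i t≡0 = begin
  sum t                     ≡⟨ sum-remove {i = i} t ⟩
  t i + sum (t ∘ punchIn i) ≡⟨ cong (_+_ (t i)) (sum-zero _ λ j → t≡0 _ (Fin.punchInᵢ≢i i j)) ⟩
  t i + 0                   ≡⟨ +-identityʳ _ ⟩
  t i                       ∎
  where open ≡-Reasoning

sum-const : ∀ n c → ∑[ i < n ] c ≡ n * c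
sum-const zero    c = refl
sum-const (suc n) c = cong (_+_ c) (sum-const n c)

sum-split : ∀ m n (f : ℕ → ℕ) →
  ∑[ i < m + n ] f (toℕ i) ≡ ∑[ i < m ] f (toℕ i) + ∑[ i < n ] f (m + toℕ i)
sum-split zero    n f = refl
sum-split (suc m) n f =
  trans (cong (_+_ (f 0)) (sum-split m n (f ∘ suc))) (sym (+-assoc (f 0) _ _))

-- Arithmetic progressions modulo `m`, and multiples of `m` in intervals.

module _ {m : ℕ} .{{_ : NonZero m}} where

  %-≡⇒∣ : ∀ a b → a % m ≡ (a + b) % m → m ∣ b
  %-≡⇒∣ a b eq = ∣m+n∣m⇒∣n (subst (m ∣_) quotients (n∣m*n ((a + b) / m))) (n∣m*n (a / m))
    where
    open ≡-Reasoning
    quotients : (a + b) / m * m ≡ a / m * m + b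
    quotients = +-cancelˡ-≡ (a % m) _ _ (begin
      a % m + (a + b) / m * m       ≡⟨ cong (_+ (a + b) / m * m) eq ⟩
      (a + b) % m + (a + b) / m * m ≡⟨ m≡m%n+[m/n]*n (a + b) m ⟨
      a + b                         ≡⟨ cong (_+ b) (m≡m%n+[m/n]*n a m) ⟩
      a % m + a / m * m + b         ≡⟨ +-assoc (a % m) _ b ⟩
      a % m + (a / m * m + b)       ∎)

module _ {m : ℕ} (m-prime : Prime m) (1<m : 1 < m) where

  private instance
    m≢0 : NonZero m
    m≢0 = prime⇒nonZero m-prime

  -- Equal residues would make `m` divide the difference (j - i)d of the two terms; but `m` is
  -- prime, 0 < j - i < m, and `m` does not divide `d`.
  progression-% : ∀ θ d → ¬ m ∣ d → (i j : Fin m) → i Fin.< j →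
    (θ + toℕ i * d) % m ≢ (θ + toℕ j * d) % m
  progression-% θ d m∤d i j i<j eq =
    [ m∤j-i , m∤d ]′ (euclidsLemma (toℕ j ∸ toℕ i) d m-prime m∣[j-i]d)
    where
    open ≡-Reasoning
    m∤j-i : ¬ m ∣ toℕ j ∸ toℕ i
    m∤j-i = >⇒∤ {{>-nonZero (m<n⇒0<n∸m i<j)}}
      (≤-<-trans (m∸n≤m (toℕ j) (toℕ i)) (Fin.toℕ<n j))
    shift : θ + toℕ j * d ≡ (θ + toℕ i * d) + (toℕ j ∸ toℕ i) * d
    shift = begin
      θ + toℕ j * d                               ≡⟨ cong (λ k → θ + k * d) (m+[n∸m]≡n (<⇒≤ i<j)) ⟨
      θ + (toℕ i + (toℕ j ∸ toℕ i)) * d           ≡⟨ cong (_+_ θ) (*-distribʳ-+ d (toℕ i) _) ⟩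
      θ + (toℕ i * d + (toℕ j ∸ toℕ i) * d)       ≡⟨ +-assoc θ _ _ ⟨
      (θ + toℕ i * d) + (toℕ j ∸ toℕ i) * d       ∎
    m∣[j-i]d : m ∣ (toℕ j ∸ toℕ i) * d
    m∣[j-i]d = %-≡⇒∣ (θ + toℕ i * d) _ (trans eq (cong (_% m) shift))

  -- The class 0 is added as an extra pigeon; since the m terms are pairwise
  -- incongruent, it must share its hole with one of them.
  progression-hits : ∀ θ d → ¬ m ∣ d → ∃[ i ] m ∣ θ + toℕ {m} i * d
  progression-hits θ d m∤d = case Fin.pigeonhole (n<1+n m) hole of λ where
      (zero , suc j , _ , eq) → j , m%n≡0⇒n∣m _ m (residue j eq)
      (suc i , suc j , s≤s i<j , eq) →
        contradiction (trans (sym (toℕ-hole i)) (trans (cong toℕ eq) (toℕ-hole j)))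
          (progression-% θ d m∤d i j i<j)
    where
    hole : Fin (suc m) → Fin m
    hole zero    = fromℕ< (<-trans (s≤s z≤n) 1<m)
    hole (suc i) = fromℕ< (m%n<n (θ + toℕ i * d) m)
    toℕ-hole : ∀ i → toℕ (hole (suc i)) ≡ (θ + toℕ i * d) % m
    toℕ-hole i = Fin.toℕ-fromℕ< _
    residue : ∀ j → hole zero ≡ hole (suc j) → (θ + toℕ j * d) % m ≡ 0
    residue j eq = trans (sym (toℕ-hole j))
      (trans (cong toℕ (sym eq)) (Fin.toℕ-fromℕ< (<-trans (s≤s z≤n) 1<m)))

  progression-count-∤ : ∀ θ d → ¬ m ∣ d → ∑[ i < m ] 𝟙 (m ∣? θ + toℕ i * d) ≡ 1
  progression-count-∤ θ d m∤d = trans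
    (sum-single _ i λ j j≢i → 𝟙-no (m ∣? _) (j≢i ∘ unique j))
    (𝟙-yes (m ∣? _) m∣θ+id)
    where
    i = proj₁ (progression-hits θ d m∤d)
    m∣θ+id = proj₂ (progression-hits θ d m∤d)
    unique : ∀ j → m ∣ θ + toℕ j * d → j ≡ i
    unique j m∣θ+jd with Fin.<-cmp j i | trans (n∣m⇒m%n≡0 _ m m∣θ+jd) (sym (n∣m⇒m%n≡0 _ m m∣θ+id))
    ... | tri< j<i _ _ | eq = contradiction eq (progression-% θ d m∤d j i j<i)
    ... | tri≈ _ j≡i _ | _  = j≡i
    ... | tri> _ _ i<j | eq = contradiction (sym eq) (progression-% θ d m∤d i j i<j)

  -- Congruent to [m ∤ d] modulo m, with the indicator [m ∣ d] moved to the left.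
  progression-count : ∀ θ d →
    ∃[ e ] ∑[ i < m ] 𝟙 (m ∣? θ + toℕ i * d) + 𝟙 (m ∣? d) ≡ 1 + m * e
  progression-count θ d with m ∣? d
  ... | no m∤d = 0 , trans (+-identityʳ _)
    (trans (progression-count-∤ θ d m∤d) (sym (cong suc (*-zeroʳ m))))
  -- All terms are congruent to `θ`, so either all `m` of them are counted or none is; the witness
  -- records which.
  ... | yes m∣d = 𝟙 (m ∣? θ) , trans (+-comm _ 1) (cong suc
    (trans (sum-cong-≗ {m} λ i → same (toℕ i)) (sum-const m _)))
    where
    same : ∀ i → 𝟙 (m ∣? θ + i * d) ≡ 𝟙 (m ∣? θ)
    same i with m ∣? θ
    ... | yes m∣θ = 𝟙-yes (m ∣? _) (∣m∣n⇒∣m+n m∣θ (∣n⇒∣m*n i m∣d))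
    ... | no  m∤θ = 𝟙-no (m ∣? _) λ m∣θ+id →
      m∤θ (∣m+n∣m⇒∣n (subst (m ∣_) (+-comm θ _) m∣θ+id) (∣n⇒∣m*n i m∣d))

  -- Each block of `m` consecutive integers is a progression of difference 1, so it contains exactly
  -- one multiple. The start `θ` is arbitrary so that the induction can pass to the blocks from
  -- `θ + m` on.
  multiples-interval : ∀ q θ → ∑[ i < m * q ] 𝟙 (m ∣? θ + toℕ i) ≡ q
  multiples-interval zero    θ rewrite *-zeroʳ m = refl
  multiples-interval (suc q) θ rewrite *-suc m q = begin
    ∑[ i < m + m * q ] 𝟙 (m ∣? θ + toℕ i)
      ≡⟨ sum-split m (m * q) (λ i → 𝟙 (m ∣? θ + i)) ⟩
    ∑[ i < m ] 𝟙 (m ∣? θ + toℕ i) + ∑[ i < m * q ] 𝟙 (m ∣? θ + (m + toℕ i))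
      ≡⟨ cong₂ _+_
           (sum-cong-≗ {m} λ i → cong (λ k → 𝟙 (m ∣? θ + k)) (sym (*-identityʳ (toℕ i))))
           (sum-cong-≗ {m * q} λ i → cong (λ k → 𝟙 (m ∣? k)) (sym (+-assoc θ m (toℕ i)))) ⟩
    ∑[ i < m ] 𝟙 (m ∣? θ + toℕ i * 1) + ∑[ i < m * q ] 𝟙 (m ∣? (θ + m) + toℕ i)
      ≡⟨ cong₂ _+_ (progression-count-∤ θ 1 (>⇒∤ 1<m)) (multiples-interval q (θ + m)) ⟩
    suc q ∎
    where open ≡-Reasoning

  -- The interval from 1 to `n` consists of `q` full blocks and a rest of `s` numbers, which lie
  -- strictly between `m * q` and `m * q + m`.
  multiples-up-to : ∀ n → ∑[ i < n ] 𝟙 (m ∣? suc (toℕ i)) ≡ n / m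
  multiples-up-to n = begin
    ∑[ i < n ] f (toℕ i)         ≡⟨ cong (λ k → ∑[ i < k ] f (toℕ i)) n≡mq+s ⟩
    ∑[ i < m * q + s ] f (toℕ i) ≡⟨ sum-split (m * q) s f ⟩
    ∑[ i < m * q ] f (toℕ i) + ∑[ i < s ] f (m * q + toℕ i)
      ≡⟨ cong₂ _+_ (multiples-interval q 1) (sum-zero {s} _ λ i → 𝟙-no (m ∣? _) (remainder i)) ⟩
    q + 0                        ≡⟨ +-identityʳ q ⟩
    q                            ∎
    where
    open ≡-Reasoning
    f : ℕ → ℕ
    f i = 𝟙 (m ∣? suc i)
    q = n / m
    s = n % m
    n≡mq+s : n ≡ m * q + s
    n≡mq+s = trans (m≡m%n+[m/n]*n n m) (trans (+-comm s _) (cong (_+ s) (*-comm q m)))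
    remainder : ∀ (i : Fin s) → ¬ m ∣ suc (m * q + toℕ i)
    remainder i m∣ = >⇒∤ (≤-<-trans (Fin.toℕ<n i) (m%n<n n m))
      (∣m+n∣m⇒∣n (subst (m ∣_) (sym (+-suc (m * q) (toℕ i))) m∣) (m∣m*n q))

-- Positions of a letter as an arithmetic progression.

module _ {n : ℕ} (x : Fin n) where

  occurrenceSum : ∀ {l} → (ℕ → ℕ) → Vec (Fin n) l → ℕ
  occurrenceSum {l} f a = ∑[ i < l ] (𝟙 (lookup a i Fin.≟ x) * f (toℕ i))

  EquallySpaced : ∀ {l} → ℕ → Vec (Fin n) l → Set
  EquallySpaced d a = ∀ i j → Consecutive a x i j → toℕ j ≡ toℕ i + d

  FirstOccurrence : ∀ {l} → Vec (Fin n) l → Fin l → Set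
  FirstOccurrence a θ = lookup a θ ≡ x × (∀ h → h Fin.< θ → lookup a h ≢ x)

  -- With `f` ranging over all weights, this determines the set of positions without listing it.
  -- Passing to the tail of a vector then only replaces `f` by `f ∘ suc`.
  Progression : ∀ {l} → ℕ → ℕ → Vec (Fin n) l → Set
  Progression θ d a = ∀ f → occurrenceSum f a ≡ ∑[ i < count (Fin._≟ x) a ] f (θ + toℕ i * d)

  equallySpaced-tail : ∀ {l d y} {a : Vec (Fin n) l} →
    EquallySpaced d (y ∷ a) → EquallySpaced d a
  equallySpaced-tail spaced i j (i<j , aᵢ , aⱼ , between) =
    suc-injective (spaced (suc i) (suc j) (s≤s i<j , aᵢ , aⱼ , λ where
      (suc h) (s≤s i<h) (s≤s h<j) → between h i<h h<j))

  -- Induction on the vector. `FirstOccurrence` is carried along because a head equal to `x` and the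
  -- first occurrence in the tail are consecutive, so the spacing condition applies to them.
  equallySpaced⇒progression : ∀ {l d} (a : Vec (Fin n) l) → EquallySpaced d a →
    (count (Fin._≟ x) a ≡ 0 × (∀ f → occurrenceSum f a ≡ 0)) ⊎
    ∃[ θ ] FirstOccurrence a θ × Progression (toℕ θ) d a
  equallySpaced⇒progression [] spaced = inj₁ (refl , λ f → refl)
  equallySpaced⇒progression {d = d} (y ∷ a) spaced
    with y Fin.≟ x | equallySpaced⇒progression a (equallySpaced-tail spaced)
  ... | no y≢x | inj₁ (none , sum≡0) = inj₁ (none , λ f → sum≡0 (f ∘ suc))
  ... | no y≢x | inj₂ (θ , (aθ , before) , prog) =
    inj₂ (suc θ , (aθ , λ where
      zero    _         → y≢x
      (suc h) (s≤s h<θ) → before h h<θ) , λ f → prog (f ∘ suc))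
  ... | yes y≡x | inj₁ (none , sum≡0) =
    inj₂ (zero , (y≡x , λ h ()) , λ f → cong₂ _+_ (*-identityˡ (f 0))
      (trans (sum≡0 (f ∘ suc)) (sym (cong (λ c → ∑[ i < c ] f (d + toℕ i * d)) none))))
  -- The progression now starts at 0. Seen from the head, that of the tail starts at `suc (toℕ θ)`,
  -- which the spacing makes equal to `d`: it supplies the terms after the first.
  ... | yes y≡x | inj₂ (θ , (aθ , before) , prog) =
    inj₂ (zero , (y≡x , λ h ()) , λ f → cong₂ _+_ (*-identityˡ (f 0))
      (trans (prog (f ∘ suc))
        (sum-cong-≗ {count (Fin._≟ x) a} λ i → cong (λ k → f (k + toℕ i * d)) 1+θ≡d)))
    where
    1+θ≡d : suc (toℕ θ) ≡ d
    1+θ≡d = spaced zero (suc θ) (s≤s z≤n , y≡x , aθ , λ where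
      (suc h) _ (s≤s h<θ) → before h h<θ)

-- After exchanging the sums, each position contributes once, through the single letter that stands
-- there.
sum-occurrenceSum : ∀ {n l} (f : ℕ → ℕ) (a : Vec (Fin n) l) →
  ∑[ x < n ] occurrenceSum x f a ≡ ∑[ i < l ] f (toℕ i)
sum-occurrenceSum {n} {l} f a = trans
  (∑-comm {n} {l} λ x i → 𝟙 (lookup a i Fin.≟ x) * f (toℕ i))
  (sum-cong-≗ {l} λ i → trans
    (sum-single _ (lookup a i) λ x x≢aᵢ →
      cong (_* f (toℕ i)) (𝟙-no (lookup a i Fin.≟ x) (x≢aᵢ ∘ sym)))
    (trans (cong (_* f (toℕ i)) (𝟙-yes (lookup a i Fin.≟ lookup a i) refl)) (*-identityˡ _)))

-- Counting positions divisible by `m` in a valid sequence.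

module _ {m n : ℕ} (m-prime : Prime m) (1<m : 1 < m) (a : Vec (Fin n) (m * n)) (valid : IsValid m a) where

  private
    instance
      m≢0 : NonZero m
      m≢0 = prime⇒nonZero m-prime

    [m∣_] : ℕ → ℕ
    [m∣ i ] = 𝟙 (m ∣? i)

  valid⇒progression : ∀ x → ∃[ θ ] (∀ f →
    occurrenceSum x f a ≡ ∑[ i < m ] f (θ + toℕ i * suc (value x)))
  valid⇒progression x with proj₁ (valid x)
    | equallySpaced⇒progression x a (λ i j c → trans (proj₂ (valid x) i j c) (sym (+-suc _ _)))
  -- Here `m` equals 0, so the sum over the progression is empty and the start 0 is a mere default.
  ... | count≡m | inj₁ (none , sum≡0) = 0 , λ f →
    trans (sum≡0 f) (cong (λ c → ∑[ i < c ] f (toℕ i * suc (value x)))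
      (trans (sym none) count≡m))
  ... | count≡m | inj₂ (θ , _ , prog) = toℕ θ , λ f →
    trans (prog f) (cong (λ c → ∑[ i < c ] f (toℕ θ + toℕ i * suc (value x))) count≡m)

  valid-occurrences : ∀ x →
    ∃[ e ] occurrenceSum x [m∣_] a + [m∣ suc (value x) ] ≡ 1 + m * e
  valid-occurrences x with valid⇒progression x
  ... | θ , prog with progression-count m-prime 1<m θ (suc (value x))
  ... | e , eq = e , trans (cong (_+ [m∣ suc (value x) ]) (prog [m∣_])) eq

  -- Summing `valid-occurrences` over all letters gives n + ⌊(n + 1) / m⌋ = n + m · `sum e`; then
  -- `n` cancels.
  valid⇒∣[1+n]/m : m ∣ suc n / m
  valid⇒∣[1+n]/m = subst (m ∣_) (sym (+-cancelˡ-≡ n _ _ (begin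
    n + suc n / m
      ≡⟨ cong₂ _+_ (sym total) (sym multiples) ⟩
    ∑[ x < n ] occurrenceSum x [m∣_] a + ∑[ x < n ] [m∣ suc (value x) ]
      ≡⟨ ∑-distrib-+ {n} _ _ ⟨
    ∑[ x < n ] (occurrenceSum x [m∣_] a + [m∣ suc (value x) ])
      ≡⟨ sum-cong-≗ {n} (proj₂ ∘ valid-occurrences) ⟩
    ∑[ x < n ] (1 + m * e x)
      ≡⟨ ∑-distrib-+ {n} (λ _ → 1) (λ x → m * e x) ⟩
    ∑[ x < n ] 1 + ∑[ x < n ] (m * e x)
      ≡⟨ cong₂ _+_ (trans (sum-const n 1) (*-identityʳ n)) (sym (*-distribˡ-sum {n} m e)) ⟩
    n + m * sum e ∎))) (m∣m*n (sum e))
    where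
    open ≡-Reasoning
    e : Fin n → ℕ
    e = proj₁ ∘ valid-occurrences
    -- Positions are counted from 0, hence the interval starting at 0.
    total : ∑[ x < n ] occurrenceSum x [m∣_] a ≡ n
    total = trans (sum-occurrenceSum [m∣_] a) (multiples-interval m-prime 1<m n 0)
    -- The differences run from 2 to n + 1; the number 1, not a multiple of `m`, is put in front to
    -- complete the interval.
    multiples : ∑[ x < n ] [m∣ suc (value x) ] ≡ suc n / m
    multiples = trans (sym (cong (_+ ∑[ x < n ] [m∣ suc (value x) ]) (𝟙-no (m ∣? 1) (>⇒∤ 1<m))))
      (multiples-up-to m-prime 1<m (suc n))

-- From a nonzero `p m n` to the congruence.

p≢0⇒valid : ∀ m n → p m n ≢ 0 → ∃[ a ] IsValid {n} {m * n} m a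
p≢0⇒valid m n p≢0
  with validSequences m n | all-filter (isValid? {n} m) (allVecs n (m * n))
-- Deduplicating an empty list leaves it empty, so `p m n` would compute to 0.
... | []    | _         = contradiction refl p≢0
... | a ∷ _ | valid ∷ _ = a , valid

theorem1 : ∀ (m n : ℕ) → 2 ≤ᴺ m → Prime m → 1 ≤ᴺ n → p m n ≢ 0 →
    ∃[ r ] (-1ℤ ≤ r × r ≤ + m - + 2 × + n ≡ r [mod + (m ^ 2) ])
theorem1 m n 2≤m m-prime 1≤n p≢0 with p≢0⇒valid m n p≢0
-- The witness is r = s - 1 for the remainder `s` of n + 1 modulo `m`; 0 ≤ s < m gives both bounds.
... | a , valid = + s - + 1 , ℤ.+-monoˡ-≤ -1ℤ {+ 0} {+ s} (ℤ.+≤+ z≤n) , s-1≤m-2 , divides (+ e) n-r≡em²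
  where
  instance
    m≢0 : NonZero m
    m≢0 = prime⇒nonZero m-prime
  s = suc n % m
  m∣q = valid⇒∣[1+n]/m m-prime 2≤m a valid
  e = quotient m∣q
  -- The quotient of n + 1 by `m` is itself `e * m`, which turns division by `m` into a statement
  -- modulo m².
  1+n≡s+em² : suc n ≡ s + e * m ^ 2
  1+n≡s+em² = trans (m≡m%n+[m/n]*n (suc n) m) (cong (_+_ s)
    (trans (cong (_* m) (m∣n⇒n≡quotient*m m∣q)) (lemma e m)))
    where
    lemma : ∀ e m → e * m * m ≡ e * (m * (m * 1))
    lemma = ℕ-Solver.solve-∀
  s-1≤m-2 : + s - + 1 ≤ + m - + 2
  s-1≤m-2 = subst (_≤ + m - + 2) (lemma (+ s)) (ℤ.+-monoˡ-≤ (ℤ.- + 2) (ℤ.+≤+ (m%n<n (suc n) m)))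
    where
    lemma : ∀ s → (+ 1 ℤ.+ s) - + 2 ≡ s - + 1
    lemma = ℤ-Solver.solve-∀
  n-r≡em² : + n - (+ s - + 1) ≡ + e ℤ.* + (m ^ 2)
  n-r≡em² = begin
    + n - (+ s - + 1)                  ≡⟨ regroup (+ n) (+ s) ⟩
    + suc n - + s                      ≡⟨ cong (λ k → + k - + s) 1+n≡s+em² ⟩
    (+ s ℤ.+ + (e * m ^ 2)) - + s      ≡⟨ cancel (+ s) (+ (e * m ^ 2)) ⟩
    + (e * m ^ 2)                      ≡⟨ ℤ.pos-* e (m ^ 2) ⟩
    + e ℤ.* + (m ^ 2)                  ∎
    where
    open ≡-Reasoning
    regroup : ∀ n s → n - (s - + 1) ≡ (+ 1 ℤ.+ n) - s
    regroup = ℤ-Solver.solve-∀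
    cancel : ∀ s k → (s ℤ.+ k) - s ≡ k
    cancel = ℤ-Solver.solve-∀
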